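{- Let $A$ be a Boolean algebra. There exists a coherent finite-separation map $s\colon A^{+}\to[A^{+}]^{<\omega}$ on the positive cone $A^{+}=A\setminus\{0\}$ if and only if $A$ is countable.
   Context: Boolean algebras are written $(A,\vee,\wedge,-,0,1)$; "countable" includes finite. $[X]^{<\omega}$ is the set of finite subsets of $X$. For a finite $F\subseteq A$ put $F^{\wedge}=\{\bigwedge G:\emptyset\neq G\subseteq F\}\setminus\{0\}$. A map $s\colon A^{+}\to[A^{+}]^{<\omega}$ is a finite-separation map if for all $a,b\in A^{+}$ with $a\wedge b=0$ there are $c,d\in s(a)\cap s(b)$ with $c\wedge d=0$, $a\leqslant c$ and $b\leqslant d$. It is coherent if, in addition, $s(a\wedge b)\subseteq (s(a)\cup s(b))^{\wedge}$ for all $a,b\in A^{+}$ with $a\wedge b>0$. -}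

module Defs where

open import Level using (Level; _⊔_)
open import Algebra.Lattice.Bundles using (BooleanAlgebra)
import Algebra.Lattice.Properties.BooleanAlgebra as BooleanAlgebraProperties
open import Data.List.Base using (List; []; _++_; foldr; map)
import Data.List.Membership.Setoid as Membership
import Data.List.Relation.Binary.Subset.Setoid as Subset
open import Data.Nat.Base using (ℕ)
open import Data.Product.Base using (Σ-syntax; ∃-syntax; _×_; _,_; proj₁; swap)
open import Function.Base using (id; _∘_)
open import Function.Bundles using (Func; Injection)
open import Relation.Binary.Bundles using (Poset; Setoid)
import Relation.Binary.Construct.On as On
open import Relation.Binary.PropositionalEquality using (_≢_; setoid)
open import Relation.Unary using (Pred)

-- A set, presented as a setoid, is countable when it injects into ℕ;
-- finite sets are countable in this sense.

Countable : ∀ {a ℓ} → Setoid a ℓ → Set (a ⊔ ℓ)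
Countable S = Injection S (setoid ℕ)

-- [X]^{<ω}: a finite subset is a list of elements, and two lists are equal
-- when they have the same members, so order and repetition are irrelevant.

finiteSubsets : ∀ {a ℓ} → Setoid a ℓ → Setoid a (a ⊔ ℓ)
finiteSubsets S = record
  { Carrier       = List (Setoid.Carrier S)
  ; _≈_           = λ X Y → (X ⊆ Y) × (Y ⊆ X)
  ; isEquivalence = record
    { refl  = id , id
    ; sym   = swap
    ; trans = λ (X⊆Y , Y⊆X) (Y⊆Z , Z⊆Y) → Y⊆Z ∘ X⊆Y , Y⊆X ∘ Z⊆Y
    }
  }
  where open Subset S using (_⊆_)

module Separation {c ℓ : Level} (A : BooleanAlgebra c ℓ) where

  open BooleanAlgebra A using (Carrier; _≈_; _≉_; _∧_; ⊤; ⊥) renaming (setoid to A-setoid)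
  open Poset (BooleanAlgebraProperties.poset A) using (_≤_)
  open Subset A-setoid using (_⊆_)

  A⁺ : Set (c ⊔ ℓ)
  A⁺ = Σ[ a ∈ Carrier ] a ≉ ⊥

  A⁺-setoid : Setoid (c ⊔ ℓ) ℓ
  A⁺-setoid = On.setoid {B = A⁺} A-setoid proj₁

  open Membership A⁺-setoid using (_∈_)

  ⋀ : List Carrier → Carrier
  ⋀ = foldr _∧_ ⊤

  _^∧ : List Carrier → Pred Carrier (c ⊔ ℓ)
  (F ^∧) x = (∃[ G ] G ≢ [] × G ⊆ F × x ≈ ⋀ G) × x ≉ ⊥

  -- Maps are setoid functions, so s a depends neither on the representative
  -- of a nor on the proof that it is nonzero.

  FiniteSetMap : Set (c ⊔ ℓ)
  FiniteSetMap = Func A⁺-setoid (finiteSubsets A⁺-setoid)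

  IsFiniteSeparation : FiniteSetMap → Set (c ⊔ ℓ)
  IsFiniteSeparation s =
    ∀ (a b : A⁺) → proj₁ a ∧ proj₁ b ≈ ⊥ →
    ∃[ c ] ∃[ d ] (c ∈ to a × c ∈ to b) × (d ∈ to a × d ∈ to b) ×
      proj₁ c ∧ proj₁ d ≈ ⊥ × proj₁ a ≤ proj₁ c × proj₁ b ≤ proj₁ d
    where open Func s using (to)

  record IsCoherentFiniteSeparation (s : FiniteSetMap) : Set (c ⊔ ℓ) where
    open Func s using (to)
    field
      isFiniteSeparation : IsFiniteSeparation s
      coherent : ∀ (a b : A⁺) (a∧b>0 : proj₁ a ∧ proj₁ b ≉ ⊥) →
                 ∀ {x} → x ∈ to (proj₁ a ∧ proj₁ b , a∧b>0) →
                 (map proj₁ (to a ++ to b) ^∧) (proj₁ x)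

{-# OPTIONS --safe #-}

-- A countable algebra is an increasing union of finite subalgebras, and s(a)
-- may be taken to be the nonzero part of the first of them that contains a.
--
-- Conversely, let C be a countable subalgebra closed under s and containing a
-- strictly smaller positive element below each of its members that has one
-- in A.  Suppose b ∉ C.  By separation b has a largest lower bound m in C; put
-- r = b − m.  For c ∈ C the complement of c ∧ b belongs to s(c ∧ b), so
-- coherence writes it as g ∧ h with g ∈ C and h a meet of elements of s(b).
-- Then − g ≤ m, so c ∧ r = − h − m, and the set {c ∧ r : c ∈ C} is finite.
-- The least upper bound in C of a minimal positive element p of this set is an
-- atom of C, hence an atom of A, hence p itself.  So p ∈ C and p ≤ b, that is,
-- p ≤ m, which contradicts p ≤ r.

module Submission where

open import Defs
open import Level using (Level; _⊔_; Lift; lift; lower)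
open import Algebra.Lattice.Bundles using (BooleanAlgebra)
import Algebra.Lattice.Properties.BooleanAlgebra as BooleanAlgebraProperties
open import Axiom.ExcludedMiddle using (ExcludedMiddle)
open import Axiom.DoubleNegationElimination using (em⇒dne)
open import Data.Empty using () renaming (⊥ to Empty)
open import Data.List.Base
  using (List; []; _∷_; [_]; _++_; map; concat; cartesianProductWith; applyDownFrom)
open import Data.List.Relation.Unary.Any as Any using (here; there)
import Data.List.Membership.Setoid as Membership
import Data.List.Membership.Setoid.Properties as Mem
open import Data.List.Membership.Propositional using (find)
open import Data.List.Membership.Propositional.Properties
  using (∈-cartesianProductWith⁺)
import Data.List.Relation.Binary.Subset.Setoid as Subset
open import Data.Maybe.Base using (Maybe; just; nothing)
open import Data.Maybe.Properties using (just-injective)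
open import Data.Nat.Base as ℕ using (ℕ; zero; suc)
open import Data.Nat.Induction using (<-rec)
import Data.Nat.Properties as ℕ
open import Data.Product.Base using (∃; ∃-syntax; _×_; _,_; proj₁; proj₂)
open import Data.Sum.Base using (inj₁; inj₂)
open import Function.Base using (_∘_)
open import Function.Bundles using (_⇔_; mk⇔; Func; Injection)
open import Relation.Binary.Bundles using (Poset; Setoid)
open import Relation.Binary.Lattice.Bundles using () renaming (Lattice to OrderLattice)
open import Relation.Binary.PropositionalEquality as ≡ using (_≡_)
import Relation.Binary.Reasoning.Setoid as ≈-Reasoning
open import Relation.Nullary.Decidable.Core using (Dec; yes; no; map′)
open import Relation.Nullary.Negation.Core using (contradiction)
open import Relation.Unary using (Pred)

-- Classical preliminaries: least witnesses and countability by codes.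

em-lower : ∀ a b → ExcludedMiddle (a ⊔ b) → ExcludedMiddle a
em-lower a b em {P} = map′ lower lift (em {Lift (a ⊔ b) P})

module _ {p : Level} {P : Pred ℕ p} where

  Least : Pred ℕ p
  Least n = P n × (∀ {m} → P m → n ℕ.≤ m)

  least : ExcludedMiddle p → ∀ n → P n → ∃ Least
  least em = <-rec _ search
    where
    search : ∀ n → (∀ {m} → m ℕ.< n → P m → ∃ Least) → P n → ∃ Least
    search n rec Pn with em {∃[ m ] m ℕ.< n × P m}
    ... | yes (m , m<n , Pm) = rec m<n Pm
    ... | no none            = n , Pn , λ {m} Pm → ℕ.≮⇒≥ λ m<n → none (m , m<n , Pm)

module _ {a ℓ r : Level} (S : Setoid a ℓ) where

  open Setoid S

  -- An element may have many codes, and the injection picks the least one. Being least, it depends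
  -- on the element only up to `≈`.
  codes⇒countable : ExcludedMiddle r → (Codes : ℕ → Pred Carrier r) →
                    (∀ {i x y} → x ≈ y → Codes i x → Codes i y) →
                    (∀ {i x y} → Codes i x → Codes i y → x ≈ y) →
                    (∀ x → ∃[ i ] Codes i x) → Countable S
  codes⇒countable em Codes resp unique total = record
    { to        = code
    ; cong      = λ x≈y → ℕ.≤-antisym (code-≤ x≈y) (code-≤ (sym x≈y))
    ; injective = λ {x} {y} eq →
        unique (coded x) (≡.subst (λ i → Codes i y) (≡.sym eq) (coded y))
    }
    where
    leastCode : ∀ x → ∃ (Least {P = λ i → Codes i x})
    leastCode x = let i , cᵢ = total x in least em i cᵢ
    code : Carrier → ℕ
    code x = proj₁ (leastCode x)
    coded : ∀ x → Codes (code x) x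
    coded x = proj₁ (proj₂ (leastCode x))
    code-≤ : ∀ {x y} → y ≈ x → code y ℕ.≤ code x
    code-≤ {x} {y} y≈x = proj₂ (proj₂ (leastCode y)) (resp (sym y≈x) (coded x))

-- Countability of the closure of a point under a finite-valued operation.

module _ {a : Level} {X : Set a} where

  nth : List X → ℕ → Maybe X
  nth []       _       = nothing
  nth (x ∷ xs) zero    = just x
  nth (x ∷ xs) (suc i) = nth xs i

  nth-++ : ∀ xs {ys i x} → nth xs i ≡ just x → nth (xs ++ ys) i ≡ just x
  nth-++ (x ∷ xs) {i = zero}  eq = eq
  nth-++ (x ∷ xs) {i = suc i} eq = nth-++ xs eq

-- Each stage is a prefix of the next one, so the position at which an element
-- first appears is a code for it that does not depend on the stage.

module Closure {a ℓ : Level} (S : Setoid a ℓ) (f : (x y : Setoid.Carrier S) → List (Setoid.Carrier S))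
               (x₀ : Setoid.Carrier S) where

  open Setoid S
  open Membership S using (_∈_)

  stage : ℕ → List Carrier
  stage zero    = [ x₀ ]
  stage (suc n) = stage n ++ concat (cartesianProductWith f (stage n) (stage n))

  Closed : Pred Carrier (a ⊔ ℓ)
  Closed x = ∃[ n ] x ∈ stage n

  base : Closed x₀
  base = 0 , here refl

  Closed-resp : ∀ {x y} → x ≈ y → Closed x → Closed y
  Closed-resp x≈y (n , x∈) = n , Mem.∈-resp-≈ S x≈y x∈

  stage-mono : ∀ {m n x} → m ℕ.≤′ n → x ∈ stage m → x ∈ stage n
  stage-mono ℕ.≤′-refl       x∈ = x∈
  stage-mono (ℕ.≤′-step m≤n) x∈ = Mem.∈-++⁺ˡ S (stage-mono m≤n x∈)

  -- `f` is not assumed to respect `≈`, so its values are reached only at the representatives `x′`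
  -- and `y′` listed in a common stage; callers transport the outcome back along `≈`.
  Closed-step : ∀ {x y} → Closed x → Closed y →
                ∃[ x′ ] ∃[ y′ ] x ≈ x′ × y ≈ y′ × (∀ {z} → z ∈ f x′ y′ → Closed z)
  Closed-step (m , x∈) (n , y∈) =
    let x′ , x′∈ , x≈x′ = find (stage-mono (ℕ.≤⇒≤′ (ℕ.m≤m⊔n m n)) x∈)
        y′ , y′∈ , y≈y′ = find (stage-mono (ℕ.≤⇒≤′ (ℕ.m≤n⊔m m n)) y∈)
    in x′ , y′ , x≈x′ , y≈y′ , λ z∈ → suc (m ℕ.⊔ n) ,
         Mem.∈-++⁺ʳ S (stage (m ℕ.⊔ n))
           (Mem.∈-concat⁺ S (Any.map (λ { ≡.refl → z∈ }) (∈-cartesianProductWith⁺ f x′∈ y′∈)))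

  Codes : ℕ → Pred Carrier (a ⊔ ℓ)
  Codes i x = ∃[ n ] ∃[ y ] nth (stage n) i ≡ just y × y ≈ x

  stage-nth : ∀ {m n i y} → m ℕ.≤′ n → nth (stage m) i ≡ just y → nth (stage n) i ≡ just y
  stage-nth ℕ.≤′-refl           eq = eq
  stage-nth (ℕ.≤′-step {n} m≤n) eq = nth-++ (stage n) (stage-nth m≤n eq)

  Codes-unique : ∀ {i x y} → Codes i x → Codes i y → x ≈ y
  Codes-unique (m , x′ , eqx , x′≈x) (n , y′ , eqy , y′≈y) =
    trans (sym x′≈x) (trans (reflexive x′≡y′) y′≈y)
    where
    x′≡y′ : x′ ≡ y′
    x′≡y′ = just-injective (≡.trans
      (≡.sym (stage-nth (ℕ.≤⇒≤′ (ℕ.m≤m⊔n m n)) eqx))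
      (stage-nth (ℕ.≤⇒≤′ (ℕ.m≤n⊔m m n)) eqy))

  ∈⇒nth : ∀ {x xs} → x ∈ xs → ∃[ i ] ∃[ y ] nth xs i ≡ just y × y ≈ x
  ∈⇒nth (here x≈y)  = 0 , _ , ≡.refl , sym x≈y
  ∈⇒nth (there x∈) = let i , r = ∈⇒nth x∈ in suc i , r

  Closed⇒countable : ExcludedMiddle (a ⊔ ℓ) → (∀ x → Closed x) → Countable S
  Closed⇒countable em all = codes⇒countable S em Codes
    (λ { x≈y (n , z , eq , z≈x) → n , z , eq , trans z≈x x≈y })
    Codes-unique
    λ x → let n , x∈ = all x ; i , r = ∈⇒nth x∈ in i , n , r

-- Minimal elements of finite sets in a poset.

module _ {a ℓ₁ ℓ₂ : Level} (P : Poset a ℓ₁ ℓ₂) where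

  open Poset P
  open Membership Eq.setoid using (_∈_)

  minimal : ExcludedMiddle (a ⊔ ℓ₁ ⊔ ℓ₂) → ∀ xs (Q : Pred Carrier (a ⊔ ℓ₁ ⊔ ℓ₂)) →
            (∀ {x} → Q x → x ∈ xs) → ∃ Q →
            ∃[ x ] Q x × (∀ {y} → Q y → y ≤ x → y ≈ x)
  minimal em []       Q Q⊆ (x , Qx) with () ← Q⊆ Qx
  minimal em (w ∷ xs) Q Q⊆ (x , Qx) with em {∃[ y ] Q y × y ≤ w × y ≉ w}
  ... | yes (y , Qy , y≤w , y≉w)
        with minimal em xs (λ z → Q z × z ≤ w × z ≉ w) tail (y , Qy , y≤w , y≉w)
      where
      tail : ∀ {z} → Q z × z ≤ w × z ≉ w → z ∈ xs
      tail (Qz , z≤w , z≉w) with Q⊆ Qz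
      ... | here z≈w = contradiction z≈w z≉w
      ... | there z∈ = z∈
  ...   | z , (Qz , z≤w , z≉w) , min = z , Qz , λ Qy y≤z →
            min (Qy , trans y≤z z≤w , λ y≈w → z≉w (antisym z≤w (trans (reflexive (Eq.sym y≈w)) y≤z))) y≤z
  minimal em (w ∷ xs) Q Q⊆ (x , Qx) | no w-min with em {∃[ y ] Q y × y ≈ w}
  ... | yes (y , Qy , y≈w) = y , Qy , λ {z} Qz z≤y →
          em⇒dne (em-lower ℓ₁ (a ⊔ ℓ₂) em) λ z≉y →
            w-min (z , Qz , trans z≤y (reflexive y≈w) , λ z≈w → z≉y (Eq.trans z≈w (Eq.sym y≈w)))
  ... | no w∉Q = minimal em xs Q tail (x , Qx)
      where
      tail : ∀ {z} → Q z → z ∈ xs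
      tail Qz with Q⊆ Qz
      ... | here z≈w = contradiction (_ , Qz , z≈w) w∉Q
      ... | there z∈ = z∈

-- Boolean calculus: order, complements and decomposition along an element.

module Boolean {c ℓ : Level} (A : BooleanAlgebra c ℓ) where

  open BooleanAlgebra A public
  open BooleanAlgebraProperties A public
  open OrderLattice ∨-∧-orderTheoreticLattice public
    using (_≤_; x∧y≤x; x∧y≤y; ∧-greatest; x≤x∨y; y≤x∨y; ∨-least)
    renaming (refl to ≤-refl; trans to ≤-trans; antisym to ≤-antisym; reflexive to ≤-reflexive)
  open ≈-Reasoning setoid

  ≤⇒∧¬ : ∀ {x y} → x ≤ y → x ∧ ¬ y ≈ ⊥
  ≤⇒∧¬ {x} {y} x≤y = begin
    -- By definition `x ≤ y` is the equation `x ≈ x ∧ y`, so order proofs serve as rewriting steps,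
    -- here and later.
    x ∧ ¬ y        ≈⟨ ∧-congʳ x≤y ⟩
    (x ∧ y) ∧ ¬ y  ≈⟨ ∧-assoc x y (¬ y) ⟩
    x ∧ (y ∧ ¬ y)  ≈⟨ ∧-congˡ (∧-complementʳ y) ⟩
    x ∧ ⊥          ≈⟨ ∧-zeroʳ x ⟩
    ⊥              ∎

  split : ∀ x r → r ≈ (x ∧ r) ∨ (¬ x ∧ r)
  split x r = begin
    r                    ≈⟨ ∧-identityˡ r ⟨
    ⊤ ∧ r                ≈⟨ ∧-congʳ (∨-complementʳ x) ⟨
    (x ∨ ¬ x) ∧ r        ≈⟨ ∧-distribʳ-∨ r x (¬ x) ⟩
    (x ∧ r) ∨ (¬ x ∧ r)  ∎

  ∧¬⇒≤ : ∀ {x y} → x ∧ ¬ y ≈ ⊥ → x ≤ y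
  ∧¬⇒≤ {x} {y} eq = begin
    x                    ≈⟨ split y x ⟩
    (y ∧ x) ∨ (¬ y ∧ x)  ≈⟨ ∨-cong (∧-comm y x) (trans (∧-comm (¬ y) x) eq) ⟩
    (x ∧ y) ∨ ⊥          ≈⟨ ∨-identityʳ (x ∧ y) ⟩
    x ∧ y                ∎

  disjoint⇒≤¬ : ∀ {x y} → x ∧ y ≈ ⊥ → x ≤ ¬ y
  disjoint⇒≤¬ {x} {y} eq = ∧¬⇒≤ (trans (∧-congˡ (¬-involutive y)) eq)

  ¬-antitone : ∀ {x y} → x ≤ y → ¬ y ≤ ¬ x
  ¬-antitone {x} {y} x≤y = disjoint⇒≤¬ (trans (∧-comm (¬ y) x) (≤⇒∧¬ x≤y))

  ≤⊥⇒≈⊥ : ∀ {x} → x ≤ ⊥ → x ≈ ⊥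
  ≤⊥⇒≈⊥ {x} x≤⊥ = trans x≤⊥ (∧-zeroʳ x)

  ≤¬self⇒≈⊥ : ∀ {x} → x ≤ ¬ x → x ≈ ⊥
  ≤¬self⇒≈⊥ {x} x≤¬x = trans x≤¬x (∧-complementʳ x)

  -- `x ∧ r ≈ x ∧ p` expresses that `r` and `p` agree below `x`. This relation is a congruence;
  -- `¬-on` is the case of complements.
  ∧-on : ∀ {x p q r s} → x ∧ r ≈ x ∧ p → x ∧ s ≈ x ∧ q → x ∧ (r ∧ s) ≈ x ∧ (p ∧ q)
  ∧-on {x} {p} {q} {r} {s} r≈p s≈q = begin
    x ∧ (r ∧ s)  ≈⟨ ∧-assoc x r s ⟨
    (x ∧ r) ∧ s  ≈⟨ ∧-congʳ (trans r≈p (∧-comm x p)) ⟩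
    (p ∧ x) ∧ s  ≈⟨ ∧-assoc p x s ⟩
    p ∧ (x ∧ s)  ≈⟨ ∧-congˡ s≈q ⟩
    p ∧ (x ∧ q)  ≈⟨ ∧-assoc p x q ⟨
    (p ∧ x) ∧ q  ≈⟨ ∧-congʳ (∧-comm p x) ⟩
    (x ∧ p) ∧ q  ≈⟨ ∧-assoc x p q ⟩
    x ∧ (p ∧ q)  ∎

  ∧¬∧ : ∀ x r → x ∧ ¬ (x ∧ r) ≈ x ∧ ¬ r
  ∧¬∧ x r = begin
    x ∧ ¬ (x ∧ r)          ≈⟨ ∧-congˡ (deMorgan₁ x r) ⟩
    x ∧ (¬ x ∨ ¬ r)        ≈⟨ ∧-distribˡ-∨ x (¬ x) (¬ r) ⟩
    (x ∧ ¬ x) ∨ (x ∧ ¬ r)  ≈⟨ ∨-congʳ (∧-complementʳ x) ⟩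
    ⊥ ∨ (x ∧ ¬ r)          ≈⟨ ∨-identityˡ (x ∧ ¬ r) ⟩
    x ∧ ¬ r                ∎

  ¬-on : ∀ {x p r} → x ∧ r ≈ x ∧ p → x ∧ ¬ r ≈ x ∧ ¬ p
  ¬-on {x} {p} {r} r≈p = begin
    x ∧ ¬ r        ≈⟨ ∧¬∧ x r ⟨
    x ∧ ¬ (x ∧ r)  ≈⟨ ∧-congˡ (¬-cong r≈p) ⟩
    x ∧ ¬ (x ∧ p)  ≈⟨ ∧¬∧ x p ⟩
    x ∧ ¬ p        ∎

  -- The algebra is the product of its ideals below `x` and below `¬ x`; this is the element with
  -- the component of `p` in the first and of `q` in the second.
  glue : Carrier → Carrier → Carrier → Carrier
  glue x p q = (x ∧ p) ∨ (¬ x ∧ q)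

  glue-unique : ∀ {x p q r} → x ∧ r ≈ x ∧ p → ¬ x ∧ r ≈ ¬ x ∧ q → r ≈ glue x p q
  glue-unique {x} {r = r} on off = trans (split x r) (∨-cong on off)

  glue-on : ∀ x p q → x ∧ glue x p q ≈ x ∧ p
  glue-on x p q = begin
    x ∧ ((x ∧ p) ∨ (¬ x ∧ q))        ≈⟨ ∧-distribˡ-∨ x (x ∧ p) (¬ x ∧ q) ⟩
    (x ∧ (x ∧ p)) ∨ (x ∧ (¬ x ∧ q))  ≈⟨ ∨-cong (∧-assoc x x p) (∧-assoc x (¬ x) q) ⟨
    ((x ∧ x) ∧ p) ∨ ((x ∧ ¬ x) ∧ q)  ≈⟨ ∨-cong (∧-congʳ (∧-idem x)) (∧-congʳ (∧-complementʳ x)) ⟩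
    (x ∧ p) ∨ (⊥ ∧ q)                ≈⟨ ∨-congˡ (∧-zeroˡ q) ⟩
    (x ∧ p) ∨ ⊥                      ≈⟨ ∨-identityʳ (x ∧ p) ⟩
    x ∧ p                            ∎

  glue-off : ∀ x p q → ¬ x ∧ glue x p q ≈ ¬ x ∧ q
  glue-off x p q = begin
    ¬ x ∧ ((x ∧ p) ∨ (¬ x ∧ q))        ≈⟨ ∧-congˡ (∨-comm (x ∧ p) (¬ x ∧ q)) ⟩
    ¬ x ∧ ((¬ x ∧ q) ∨ (x ∧ p))        ≈⟨ ∧-congˡ (∨-congˡ (∧-congʳ (¬-involutive x))) ⟨
    ¬ x ∧ glue (¬ x) q p               ≈⟨ glue-on (¬ x) q p ⟩
    ¬ x ∧ q                            ∎

-- Countability implies separation: finitely generated subalgebras.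

module Countable⇒Separation {c ℓ : Level} (em : ExcludedMiddle (c ⊔ ℓ)) (A : BooleanAlgebra c ℓ)
                            (A-countable : Countable (BooleanAlgebra.setoid A)) where

  open Boolean A
  open Separation A using (A⁺; A⁺-setoid; FiniteSetMap; IsCoherentFiniteSeparation)
  open Injection A-countable using () renaming (to to code; injective to code-injective)
  open Membership setoid using (_∈_)
  open Membership A⁺-setoid using () renaming (_∈_ to _∈⁺_)

  -- The subalgebra generated by the list: adjoining `x` to a subalgebra yields exactly the elements
  -- that agree with one member below `x` and with another below `¬ x`.
  span : List Carrier → List Carrier
  span []       = ⊤ ∷ ⊥ ∷ []
  span (x ∷ xs) = cartesianProductWith (glue x) (span xs) (span xs)

  -- With `span⁻`, membership in terms of components, so that closure under the operations is
  -- inherited from `span xs` on either side of `x`.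
  span⁺ : ∀ x xs {p q r} → p ∈ span xs → q ∈ span xs →
          x ∧ r ≈ x ∧ p → ¬ x ∧ r ≈ ¬ x ∧ q → r ∈ span (x ∷ xs)
  span⁺ x xs p∈ q∈ on off = Mem.∈-resp-≈ setoid (sym (glue-unique on off))
    (Mem.∈-cartesianProductWith⁺ setoid setoid setoid
      (λ p≈p′ q≈q′ → ∨-cong (∧-congˡ p≈p′) (∧-congˡ q≈q′)) p∈ q∈)

  span⁻ : ∀ x xs {r} → r ∈ span (x ∷ xs) →
          ∃[ p ] ∃[ q ] p ∈ span xs × q ∈ span xs × x ∧ r ≈ x ∧ p × ¬ x ∧ r ≈ ¬ x ∧ q
  span⁻ x xs r∈ =
    let p , q , p∈ , q∈ , r≈ = Mem.∈-cartesianProductWith⁻ setoid setoid setoid (glue x) (span xs) (span xs) r∈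
    in p , q , p∈ , q∈ , trans (∧-congˡ r≈) (glue-on x p q) , trans (∧-congˡ r≈) (glue-off x p q)

  span-there : ∀ x xs {r} → r ∈ span xs → r ∈ span (x ∷ xs)
  span-there x xs r∈ = span⁺ x xs r∈ r∈ refl refl

  span-¬ : ∀ xs {r} → r ∈ span xs → ¬ r ∈ span xs
  span-¬ []       (here r≈⊤)         = there (here (trans (¬-cong r≈⊤) ¬⊤≈⊥))
  span-¬ []       (there (here r≈⊥)) = here (trans (¬-cong r≈⊥) ¬⊥≈⊤)
  span-¬ (x ∷ xs) r∈ =
    let _ , _ , p∈ , q∈ , on , off = span⁻ x xs r∈
    in span⁺ x xs (span-¬ xs p∈) (span-¬ xs q∈) (¬-on on) (¬-on off)

  span-∧ : ∀ xs {r s} → r ∈ span xs → s ∈ span xs → r ∧ s ∈ span xs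
  span-∧ []       {s = s} (here r≈⊤) s∈ =
    Mem.∈-resp-≈ setoid (sym (trans (∧-congʳ r≈⊤) (∧-identityˡ s))) s∈
  span-∧ []       {s = s} (there (here r≈⊥)) s∈ = there (here (trans (∧-congʳ r≈⊥) (∧-zeroˡ s)))
  span-∧ (x ∷ xs) r∈ s∈ =
    let _ , _ , p∈ , q∈ , on , off = span⁻ x xs r∈
        _ , _ , p′∈ , q′∈ , on′ , off′ = span⁻ x xs s∈
    in span⁺ x xs (span-∧ xs p∈ p′∈) (span-∧ xs q∈ q′∈) (∧-on on on′) (∧-on off off′)

  ⊤∈span : ∀ xs → ⊤ ∈ span xs
  ⊤∈span []       = here refl
  ⊤∈span (x ∷ xs) = span-there x xs (⊤∈span xs)

  span-here : ∀ {x} xs → x ∈ span (x ∷ xs)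
  -- `x` agrees with `⊤` below `x` and with `¬ ⊤` below `¬ x`.
  span-here {x} xs = span⁺ x xs (⊤∈span xs) (span-¬ xs (⊤∈span xs))
    (trans (∧-idem x) (sym (∧-identityʳ x)))
    (trans (∧-complementˡ x) (sym (trans (∧-congˡ ¬⊤≈⊥) (∧-zeroʳ (¬ x)))))

  -- The chain of finite subalgebras of a countable algebra.

  decode′ : ∀ {i} → Dec (∃[ x ] code x ≡ i) → Carrier
  decode′ (yes (x , _)) = x
  -- A number that codes nothing contributes `⊤`, which lies in every subalgebra anyway.
  decode′ (no  _)       = ⊤

  decode : ℕ → Carrier
  decode i = decode′ {i} (em-lower c ℓ em)

  decode-code : ∀ x → decode (code x) ≈ x
  decode-code x with em-lower c ℓ em {∃[ y ] code y ≡ code x}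
  ... | yes (y , eq) = code-injective eq
  ... | no none      = contradiction (x , ≡.refl) none

  -- The newest generator comes first: `gens (suc n)` reduces to `decode n ∷ gens n`, so
  -- `span-there` makes the chain increasing.
  gens : ℕ → List Carrier
  gens = applyDownFrom decode

  subalg : ℕ → List Carrier
  subalg n = span (gens n)

  subalg-mono′ : ∀ {m n x} → m ℕ.≤′ n → x ∈ subalg m → x ∈ subalg n
  subalg-mono′ ℕ.≤′-refl           x∈ = x∈
  subalg-mono′ (ℕ.≤′-step {n} m≤n) x∈ = span-there (decode n) (gens n) (subalg-mono′ m≤n x∈)

  subalg-mono : ∀ {m n x} → m ℕ.≤ n → x ∈ subalg m → x ∈ subalg n
  subalg-mono m≤n = subalg-mono′ (ℕ.≤⇒≤′ m≤n)

  leastStage : ∀ x → ∃ (Least {P = λ n → x ∈ subalg n})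
  -- `gens n` decodes the numbers below `n`, so `x` is, up to `≈`, a generator of stage
  -- `suc (code x)`.
  leastStage x = least em (suc (code x))
    (Mem.∈-resp-≈ setoid (decode-code x) (span-here (gens (code x))))

  rank : Carrier → ℕ
  rank x = proj₁ (leastStage x)

  ∈-rank : ∀ x → x ∈ subalg (rank x)
  ∈-rank x = proj₁ (proj₂ (leastStage x))

  rank-≤ : ∀ {n} x → x ∈ subalg n → rank x ℕ.≤ n
  rank-≤ x = proj₂ (proj₂ (leastStage x))

  -- The separation map given by the chain.

  nonzero : List Carrier → List A⁺
  nonzero []       = []
  nonzero (x ∷ xs) with em-lower ℓ c em {x ≈ ⊥}
  ... | yes _  = nonzero xs
  ... | no x≉⊥ = (x , x≉⊥) ∷ nonzero xs

  nonzero⁺ : ∀ xs (x : A⁺) → proj₁ x ∈ xs → x ∈⁺ nonzero xs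
  nonzero⁺ (y ∷ xs) x x∈ with em-lower ℓ c em {y ≈ ⊥} | x∈
  ... | yes y≈⊥ | here x≈y  = contradiction (trans x≈y y≈⊥) (proj₂ x)
  ... | yes _   | there x∈′ = nonzero⁺ xs x x∈′
  ... | no _    | here x≈y  = here x≈y
  ... | no _    | there x∈′ = there (nonzero⁺ xs x x∈′)

  nonzero⁻ : ∀ xs (x : A⁺) → x ∈⁺ nonzero xs → proj₁ x ∈ xs
  nonzero⁻ (y ∷ xs) x x∈ with em-lower ℓ c em {y ≈ ⊥}
  ... | yes _ = there (nonzero⁻ xs x x∈)
  nonzero⁻ (y ∷ xs) x (here x≈y) | no _ = here x≈y
  nonzero⁻ (y ∷ xs) x (there x∈) | no _ = there (nonzero⁻ xs x x∈)

  sep : A⁺ → List A⁺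
  sep a = nonzero (subalg (rank (proj₁ a)))

  sep⁺ : ∀ (a x : A⁺) {n} → n ℕ.≤ rank (proj₁ a) → proj₁ x ∈ subalg n → x ∈⁺ sep a
  sep⁺ a x n≤ x∈ = nonzero⁺ _ x (subalg-mono n≤ x∈)

  sep⁻ : ∀ (a x : A⁺) → x ∈⁺ sep a → proj₁ x ∈ subalg (rank (proj₁ a))
  sep⁻ a x = nonzero⁻ _ x

  rank-resp : ∀ {x y} → x ≈ y → rank x ℕ.≤ rank y
  rank-resp {x} {y} x≈y = rank-≤ x (Mem.∈-resp-≈ setoid (sym x≈y) (∈-rank y))

  sepMap : FiniteSetMap
  sepMap = record
    { to   = sep
    ; cong = λ {a} {b} a≈b →
        (λ {x} x∈ → sep⁺ b x (rank-resp a≈b) (sep⁻ a x x∈)) ,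
        (λ {x} x∈ → sep⁺ a x (rank-resp (sym a≈b)) (sep⁻ b x x∈))
    }

  sepMap-coherent : IsCoherentFiniteSeparation sepMap
  sepMap-coherent = record { isFiniteSeparation = separates ; coherent = coherent }
    where
    open Separation A using (IsFiniteSeparation; _^∧)

    ¬≉⊥ : ∀ {x y} → y ≉ ⊥ → y ≤ ¬ x → ¬ x ≉ ⊥
    ¬≉⊥ y≉⊥ y≤¬x ¬x≈⊥ = y≉⊥ (≤⊥⇒≈⊥ (≤-trans y≤¬x (≤-reflexive ¬x≈⊥)))

    separates : IsFiniteSeparation sepMap
    -- The element of smaller rank and its complement do the separating: both lie in the smaller
    -- subalgebra, hence in both values of the map.
    separates a b a∧b≈⊥ with ℕ.≤-total (rank (proj₁ a)) (rank (proj₁ b))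
    ... | inj₁ a≤b =
      a , ¬a , (sep⁺ a a ℕ.≤-refl a∈ , sep⁺ b a a≤b a∈) ,
      (sep⁺ a ¬a ℕ.≤-refl ¬a∈ , sep⁺ b ¬a a≤b ¬a∈) ,
      ∧-complementʳ (proj₁ a) , ≤-refl , b≤¬a
      where
      b≤¬a : proj₁ b ≤ ¬ proj₁ a
      b≤¬a = disjoint⇒≤¬ (trans (∧-comm _ _) a∧b≈⊥)
      ¬a : A⁺
      ¬a = ¬ proj₁ a , ¬≉⊥ (proj₂ b) b≤¬a
      a∈ = ∈-rank (proj₁ a)
      ¬a∈ = span-¬ (gens (rank (proj₁ a))) a∈
    ... | inj₂ b≤a =
      ¬b , b , (sep⁺ a ¬b b≤a ¬b∈ , sep⁺ b ¬b ℕ.≤-refl ¬b∈) ,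
      (sep⁺ a b b≤a b∈ , sep⁺ b b ℕ.≤-refl b∈) ,
      ∧-complementˡ (proj₁ b) , a≤¬b , ≤-refl
      where
      a≤¬b : proj₁ a ≤ ¬ proj₁ b
      a≤¬b = disjoint⇒≤¬ a∧b≈⊥
      ¬b : A⁺
      ¬b = ¬ proj₁ b , ¬≉⊥ (proj₂ a) a≤¬b
      b∈ = ∈-rank (proj₁ b)
      ¬b∈ = span-¬ (gens (rank (proj₁ b))) b∈

    -- The larger of the two subalgebras contains `a`, `b` and hence their meet, whose rank is
    -- therefore no larger. So `x` already belongs to one of the two values and is the meet of a
    -- one-element list.
    coherent : ∀ (a b : A⁺) (a∧b>0 : proj₁ a ∧ proj₁ b ≉ ⊥) {x} →
               x ∈⁺ sep (proj₁ a ∧ proj₁ b , a∧b>0) → (map proj₁ (sep a ++ sep b) ^∧) (proj₁ x)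
    coherent a b a∧b>0 {x} x∈ =
      ([ proj₁ x ] , (λ ()) , (λ { (here y≈x) → Mem.∈-resp-≈ setoid (sym y≈x) x∈map }) ,
       sym (∧-identityʳ (proj₁ x))) , proj₂ x
      where
      x∈sub = sep⁻ (proj₁ a ∧ proj₁ b , a∧b>0) x x∈
      x∈++ : x ∈⁺ sep a ++ sep b
      x∈++ with ℕ.≤-total (rank (proj₁ a)) (rank (proj₁ b))
      ... | inj₁ a≤b = Mem.∈-++⁺ʳ A⁺-setoid {x} (sep a) (sep⁺ b x
              (rank-≤ _ (span-∧ (gens (rank (proj₁ b)))
                (subalg-mono a≤b (∈-rank (proj₁ a))) (∈-rank (proj₁ b)))) x∈sub)
      ... | inj₂ b≤a = Mem.∈-++⁺ˡ A⁺-setoid {x} (sep⁺ a x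
              (rank-≤ _ (span-∧ (gens (rank (proj₁ a)))
                (∈-rank (proj₁ a)) (subalg-mono b≤a (∈-rank (proj₁ b))))) x∈sub)
      x∈map : proj₁ x ∈ map proj₁ (sep a ++ sep b)
      x∈map = Mem.∈-map⁺ A⁺-setoid setoid (λ y≈z → y≈z) {x} x∈++


-- Separation implies countability: the map extended to the whole algebra.

module Separation⇒Countable {c ℓ : Level} (em : ExcludedMiddle (c ⊔ ℓ)) (A : BooleanAlgebra c ℓ)
                            (s : Separation.FiniteSetMap A)
                            (s-coherent : Separation.IsCoherentFiniteSeparation A s) where

  open Boolean A
  open Separation A using (A⁺; A⁺-setoid; ⋀; module IsCoherentFiniteSeparation)
  open IsCoherentFiniteSeparation s-coherent
  open Func s using () renaming (to to sep; cong to sep-cong)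
  open Membership setoid using (_∈_)
  open Membership A⁺-setoid using () renaming (_∈_ to _∈⁺_)
  open Subset setoid using (_⊆_)
  open ≈-Reasoning setoid

  -- The value `[]` at `⊥` makes the map total on the carrier, so that it can be one of the
  -- operations that generate `C`.
  sepList : Carrier → List Carrier
  sepList x with em-lower ℓ c em {x ≈ ⊥}
  ... | yes _  = []
  ... | no x≉⊥ = map proj₁ (sep (x , x≉⊥))

  -- Excluded middle supplies its own proof that the element is nonzero; `sep-cong` identifies the
  -- values at the two proofs.
  sepList⁺ : ∀ (a : A⁺) {x} → x ∈ map proj₁ (sep a) → x ∈ sepList (proj₁ a)
  sepList⁺ (a , a≉⊥) x∈ with em-lower ℓ c em {a ≈ ⊥}
  ... | yes a≈⊥ = contradiction a≈⊥ a≉⊥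
  ... | no a≉⊥′ =
    let y , y∈ , x≈y = Mem.∈-map⁻ A⁺-setoid setoid x∈
    in Mem.∈-resp-≈ setoid (sym x≈y)
         (Mem.∈-map⁺ A⁺-setoid setoid (λ y≈z → y≈z) {y} (proj₁ (sep-cong {a , a≉⊥} {a , a≉⊥′} refl) {y} y∈))

  sepList-member : ∀ (a x : A⁺) → x ∈⁺ sep a → proj₁ x ∈ sepList (proj₁ a)
  sepList-member a x x∈ = sepList⁺ a (Mem.∈-map⁺ A⁺-setoid setoid (λ y≈z → y≈z) {x} x∈)

  sepList-resp : ∀ {a b} → a ≈ b → sepList a ⊆ sepList b
  sepList-resp {a} {b} a≈b {x} x∈ with em-lower ℓ c em {a ≈ ⊥} | x∈
  ... | yes _  | ()
  ... | no a≉⊥ | x∈′ =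
    let b⁺ = b , a≉⊥ ∘ trans a≈b
        y , y∈ , x≈y = Mem.∈-map⁻ A⁺-setoid setoid x∈′
    in Mem.∈-resp-≈ setoid (sym x≈y) (sepList-member b⁺ y (proj₁ (sep-cong {a , a≉⊥} {b⁺} a≈b) {y} y∈))

  sepList-separates : ∀ {a b} → a ≉ ⊥ → b ≉ ⊥ → a ∧ b ≈ ⊥ →
                      ∃[ x ] ∃[ y ] (x ∈ sepList a × x ∈ sepList b) × (y ∈ sepList a × y ∈ sepList b) ×
                        x ∧ y ≈ ⊥ × a ≤ x × b ≤ y
  sepList-separates {a} {b} a≉⊥ b≉⊥ a∧b≈⊥ =
    let a⁺ = a , a≉⊥ ; b⁺ = b , b≉⊥
        x , y , (x∈a , x∈b) , (y∈a , y∈b) , rest = isFiniteSeparation a⁺ b⁺ a∧b≈⊥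
    in proj₁ x , proj₁ y ,
       (sepList-member a⁺ x x∈a , sepList-member b⁺ x x∈b) ,
       (sepList-member a⁺ y y∈a , sepList-member b⁺ y y∈b) , rest

  -- Disjoint elements above `a` and above `¬ a` can only be these two themselves, so separating `a`
  -- from its complement puts the complement into the finite set.
  ¬∈sepList : ∀ {a} → a ≉ ⊥ → ¬ a ≉ ⊥ → ¬ a ∈ sepList a
  ¬∈sepList {a} a≉⊥ ¬a≉⊥ =
    let x , y , _ , (y∈ , _) , x∧y≈⊥ , a≤x , ¬a≤y = sepList-separates a≉⊥ ¬a≉⊥ (∧-complementʳ a)
        y≤¬a = ≤-trans (disjoint⇒≤¬ (trans (∧-comm y x) x∧y≈⊥)) (¬-antitone a≤x)
    in Mem.∈-resp-≈ setoid (≤-antisym y≤¬a ¬a≤y) y∈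

  sepList-coherent : ∀ {a b} → a ∧ b ≉ ⊥ → ∀ {x} → x ∈ sepList (a ∧ b) →
                     ∃[ G ] G ⊆ sepList a ++ sepList b × x ≈ ⋀ G
  sepList-coherent {a} {b} a∧b≉⊥ {x} x∈ with em-lower ℓ c em {a ∧ b ≈ ⊥} | x∈
  ... | yes a∧b≈⊥ | _   = contradiction a∧b≈⊥ a∧b≉⊥
  ... | no a∧b≉⊥′ | x∈′ =
    let y , y∈ , x≈y = Mem.∈-map⁻ A⁺-setoid setoid x∈′
        (G , _ , G⊆ , y≈⋀G) , _ = coherent a⁺ b⁺ a∧b≉⊥′ {y} y∈
    in G , incl ∘ G⊆ , trans x≈y y≈⋀G
    where
    a⁺ b⁺ : A⁺
    a⁺ = a , λ a≈⊥ → a∧b≉⊥ (trans (∧-congʳ a≈⊥) (∧-zeroˡ b))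
    b⁺ = b , λ b≈⊥ → a∧b≉⊥ (trans (∧-congˡ b≈⊥) (∧-zeroʳ a))
    incl : map proj₁ (sep a⁺ ++ sep b⁺) ⊆ sepList a ++ sepList b
    incl z∈ with Mem.∈-map⁻ A⁺-setoid setoid z∈
    ... | y , y∈ , z≈y with Mem.∈-++⁻ A⁺-setoid {y} (sep a⁺) y∈
    ...   | inj₁ y∈a = Mem.∈-resp-≈ setoid (sym z≈y) (Mem.∈-++⁺ˡ setoid (sepList-member a⁺ y y∈a))
    ...   | inj₂ y∈b = Mem.∈-resp-≈ setoid (sym z≈y) (Mem.∈-++⁺ʳ setoid (sepList a) (sepList-member b⁺ y y∈b))

  -- The countable subalgebra `C`.

  ProperPart : Carrier → Pred Carrier ℓ
  ProperPart x y = y ≤ x × y ≉ ⊥ × y ≉ x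

  ProperPart-resp : ∀ {x x′ y} → x ≈ x′ → ProperPart x y → ProperPart x′ y
  ProperPart-resp x≈x′ (y≤x , y≉⊥ , y≉x) =
    ≤-trans y≤x (≤-reflexive x≈x′) , y≉⊥ , λ y≈x′ → y≉x (trans y≈x′ (sym x≈x′))

  -- A positive element without a proper part is an atom, so closing `C` under this choice turns
  -- atoms of `C` into atoms of the whole algebra.
  shrink : Carrier → Carrier
  shrink x with em {∃[ y ] ProperPart x y}
  ... | yes (y , _) = y
  -- Nothing new is generated here, as `x` is already present.
  ... | no _        = x

  shrink-proper : ∀ {x y} → ProperPart x y → ProperPart x (shrink x)
  shrink-proper {x} {y} y-proper with em {∃[ z ] ProperPart x z}
  ... | yes (_ , z-proper) = z-proper
  ... | no none            = contradiction (y , y-proper) none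

  generate : Carrier → Carrier → List Carrier
  generate x y = ¬ x ∷ x ∧ y ∷ shrink x ∷ sepList x

  open Closure setoid generate ⊤ renaming (Closed to C; Closed-resp to C-resp)

  C-¬ : ∀ {x} → C x → C (¬ x)
  C-¬ Cx =
    let _ , _ , x≈x′ , _ , step = Closed-step Cx Cx
    in C-resp (¬-cong (sym x≈x′)) (step (here refl))

  C-∧ : ∀ {x y} → C x → C y → C (x ∧ y)
  C-∧ Cx Cy =
    let _ , _ , x≈x′ , y≈y′ , step = Closed-step Cx Cy
    in C-resp (∧-cong (sym x≈x′) (sym y≈y′)) (step (there (here refl)))

  C-∨ : ∀ {x y} → C x → C y → C (x ∨ y)
  C-∨ {x} {y} Cx Cy = C-resp
    (trans (deMorgan₁ (¬ x) (¬ y)) (∨-cong (¬-involutive x) (¬-involutive y)))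
    (C-¬ (C-∧ (C-¬ Cx) (C-¬ Cy)))

  C-⊥ : C ⊥
  C-⊥ = C-resp ¬⊤≈⊥ (C-¬ base)

  C-sepList : ∀ {x y} → C x → y ∈ sepList x → C y
  C-sepList Cx y∈ =
    let _ , _ , x≈x′ , _ , step = Closed-step Cx Cx
    in step (there (there (there (sepList-resp x≈x′ y∈))))

  C-properPart : ∀ {x y} → C x → ProperPart x y → ∃[ z ] C z × ProperPart x z
  C-properPart Cx y-proper =
    let x′ , _ , x≈x′ , _ , step = Closed-step Cx Cx
    in shrink x′ , step (there (there (here refl))) ,
       ProperPart-resp (sym x≈x′) (shrink-proper (ProperPart-resp x≈x′ y-proper))

  -- Projections to `C`.

  IsLowerProjection : Carrier → Pred Carrier (c ⊔ ℓ)
  IsLowerProjection b m = C m × m ≤ b × (∀ {u} → C u → u ≤ b → u ≤ m)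

  lowerBoundIn : ∀ b xs → ∃[ m ] C m × m ≤ b × (∀ {x} → x ∈ xs → C x → x ≤ b → x ≤ m)
  lowerBoundIn b []       = ⊥ , C-⊥ , sym (∧-zeroˡ b) , λ ()
  lowerBoundIn b (y ∷ xs) with lowerBoundIn b xs | em {C y × y ≤ b}
  ... | m , Cm , m≤b , above | yes (Cy , y≤b) =
    y ∨ m , C-∨ Cy Cm , ∨-least y≤b m≤b , λ
      { (here x≈y)  _  _   → ≤-trans (≤-reflexive x≈y) (x≤x∨y y m)
      ; (there x∈) Cx x≤b → ≤-trans (above x∈ Cx x≤b) (y≤x∨y y m) }
  ... | m , Cm , m≤b , above | no ¬y = m , Cm , m≤b , λ
      { (here x≈y)  Cx x≤b → contradiction (C-resp x≈y Cx , ≤-trans (≤-reflexive (sym x≈y)) x≤b) ¬y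
      ; (there x∈) Cx x≤b → above x∈ Cx x≤b }

  -- Separating a positive `u` in `C` below `b` from `¬ b` gives an element between `u` and `b` that
  -- belongs to `sepList u`, hence to `C`, and to `sepList (¬ b)`. The join of the finitely many
  -- suitable members of the latter list thus bounds every such `u`.
  lowerProjection : ∀ b → ∃ (IsLowerProjection b)
  lowerProjection b with em-lower ℓ c em {¬ b ≈ ⊥}
  ... | yes ¬b≈⊥ = ⊤ , base , ⊤≤b , λ {u} _ _ → sym (∧-identityʳ u)
    where
    ⊤≤b : ⊤ ≤ b
    ⊤≤b = ∧¬⇒≤ (trans (∧-identityˡ (¬ b)) ¬b≈⊥)
  ... | no ¬b≉⊥ =
    let m , Cm , m≤b , above = lowerBoundIn b (sepList (¬ b))
    in m , Cm , m≤b , λ {u} Cu u≤b → below m above Cu u≤b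
    where
    below : ∀ m → (∀ {x} → x ∈ sepList (¬ b) → C x → x ≤ b → x ≤ m) →
            ∀ {u} → C u → u ≤ b → u ≤ m
    below m above {u} Cu u≤b with em-lower ℓ c em {u ≈ ⊥}
    ... | yes u≈⊥ = ≤-trans (≤-reflexive u≈⊥) (sym (∧-zeroˡ m))
    ... | no u≉⊥  =
      let x , y , (x∈u , x∈¬b) , _ , x∧y≈⊥ , u≤x , ¬b≤y = sepList-separates u≉⊥ ¬b≉⊥ (≤⇒∧¬ u≤b)
          x≤b = ≤-trans (disjoint⇒≤¬ x∧y≈⊥)
                  (≤-trans (¬-antitone ¬b≤y) (≤-reflexive (¬-involutive b)))
      in ≤-trans u≤x (above x∈¬b (C-sepList Cu x∈u) x≤b)

  IsUpperProjection : Carrier → Pred Carrier (c ⊔ ℓ)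
  IsUpperProjection p e = C e × p ≤ e × (∀ {u} → C u → p ≤ u → e ≤ u)

  -- Complementation turns the largest member below `¬ p` into the least member above `p`.
  upperProjection : ∀ p → ∃ (IsUpperProjection p)
  upperProjection p =
    let m , Cm , m≤¬p , greatest = lowerProjection (¬ p)
    in ¬ m , C-¬ Cm , ≤-trans (≤-reflexive (sym (¬-involutive p))) (¬-antitone m≤¬p) ,
       λ {u} Cu p≤u → ≤-trans (¬-antitone (greatest (C-¬ Cu) (¬-antitone p≤u)))
                              (≤-reflexive (¬-involutive u))

  -- Finiteness of the traces of `C`.

  meets : List Carrier → List Carrier
  meets []       = [ ⊤ ]
  meets (x ∷ xs) = meets xs ++ map (x ∧_) (meets xs)

  ⊤∈meets : ∀ xs → ⊤ ∈ meets xs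
  ⊤∈meets []       = here refl
  ⊤∈meets (x ∷ xs) = Mem.∈-++⁺ˡ setoid (⊤∈meets xs)

  -- A list of factors may repeat entries without bound; this keeps all the resulting meets in one
  -- finite list, because a repeated factor is absorbed.
  meets-∧ : ∀ {x h} xs → x ∈ xs → h ∈ meets xs → x ∧ h ∈ meets xs
  meets-∧ {x} {h} (y ∷ xs) x∈ h∈ with Mem.∈-++⁻ setoid (meets xs) h∈ | x∈
  ... | inj₁ h∈′ | here x≈y = Mem.∈-++⁺ʳ setoid (meets xs)
    (Mem.∈-resp-≈ setoid (∧-congʳ (sym x≈y)) (Mem.∈-map⁺ setoid setoid ∧-congˡ h∈′))
  ... | inj₁ h∈′ | there x∈′ = Mem.∈-++⁺ˡ setoid (meets-∧ xs x∈′ h∈′)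
  ... | inj₂ h∈′ | here x≈y =
    Mem.∈-resp-≈ setoid (sym x∧h≈h) h∈
    where
    x∧h≈h : x ∧ h ≈ h
    x∧h≈h =
      let k , _ , h≈y∧k = Mem.∈-map⁻ setoid setoid h∈′
          h≤x = ≤-trans (≤-reflexive h≈y∧k) (≤-trans (x∧y≤x y k) (≤-reflexive (sym x≈y)))
      in trans (∧-comm x h) (sym h≤x)
  ... | inj₂ h∈′ | there x∈′ =
    let k , k∈ , h≈y∧k = Mem.∈-map⁻ setoid setoid h∈′
    in Mem.∈-++⁺ʳ setoid (meets xs) (Mem.∈-resp-≈ setoid
         (sym (begin
           x ∧ h        ≈⟨ ∧-congˡ h≈y∧k ⟩
           x ∧ (y ∧ k)  ≈⟨ ∧-assoc x y k ⟨
           (x ∧ y) ∧ k  ≈⟨ ∧-congʳ (∧-comm x y) ⟩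
           (y ∧ x) ∧ k  ≈⟨ ∧-assoc y x k ⟩
           y ∧ (x ∧ k)  ∎))
         (Mem.∈-map⁺ setoid setoid ∧-congˡ (meets-∧ xs x∈′ k∈)))

  -- The factors are sorted by origin: those from `xs` merge into one element of `C`, while those
  -- from `ys` leave only finitely many possibilities for `h`.
  ⋀-split : ∀ {xs} ys → (∀ {x} → x ∈ xs → C x) → ∀ G → G ⊆ xs ++ ys →
            ∃[ g ] ∃[ h ] C g × h ∈ meets ys × ⋀ G ≈ g ∧ h
  ⋀-split ys C-xs [] G⊆ = ⊤ , ⊤ , base , ⊤∈meets ys , sym (∧-idem ⊤)
  ⋀-split {xs} ys C-xs (z ∷ G) G⊆
    with ⋀-split ys C-xs G (G⊆ ∘ there) | Mem.∈-++⁻ setoid xs (G⊆ (here refl))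
  ... | g , h , Cg , h∈ , eq | inj₁ z∈xs =
    z ∧ g , h , C-∧ (C-xs z∈xs) Cg , h∈ , trans (∧-congˡ eq) (sym (∧-assoc z g h))
  ... | g , h , Cg , h∈ , eq | inj₂ z∈ys =
    g , z ∧ h , Cg , meets-∧ ys z∈ys h∈ , (begin
      z ∧ ⋀ G      ≈⟨ ∧-congˡ eq ⟩
      z ∧ (g ∧ h)  ≈⟨ ∧-assoc z g h ⟨
      (z ∧ g) ∧ h  ≈⟨ ∧-congʳ (∧-comm z g) ⟩
      (g ∧ z) ∧ h  ≈⟨ ∧-assoc g z h ⟩
      g ∧ (z ∧ h)  ∎)

  -- The candidates do not depend on the member of `C` that cuts the remainder `b ∧ ¬ m`. The entry
  -- `⊥` serves the members disjoint from `b`, at which coherence says nothing.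
  traces : Carrier → Carrier → List Carrier
  traces b m = ⊥ ∷ map (λ h → ¬ h ∧ ¬ m) (meets (sepList b))

  trace∈ : ∀ {b m d} → ¬ b ≉ ⊥ → IsLowerProjection b m → C d → d ∧ (b ∧ ¬ m) ∈ traces b m
  trace∈ {b} {m} {d} ¬b≉⊥ (_ , _ , greatest) Cd with em-lower ℓ c em {d ∧ b ≈ ⊥}
  ... | yes d∧b≈⊥ = here (begin
    d ∧ (b ∧ ¬ m)  ≈⟨ ∧-assoc d b (¬ m) ⟨
    (d ∧ b) ∧ ¬ m  ≈⟨ ∧-congʳ d∧b≈⊥ ⟩
    ⊥ ∧ ¬ m        ≈⟨ ∧-zeroˡ (¬ m) ⟩
    ⊥              ∎)
  ... | no d∧b≉⊥ =
    -- Here `x` stands for `d ∧ b`; its complement lies above the positive element `¬ b`.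
    let ¬x≉⊥ = λ ¬x≈⊥ → ¬b≉⊥ (≤⊥⇒≈⊥ (≤-trans (¬-antitone (x∧y≤y d b)) (≤-reflexive ¬x≈⊥)))
        G , G⊆ , ¬x≈⋀G = sepList-coherent d∧b≉⊥ (¬∈sepList d∧b≉⊥ ¬x≉⊥)
        g , h , Cg , h∈ , ⋀G≈g∧h = ⋀-split (sepList b) (C-sepList Cd) G G⊆
    in there (Mem.∈-resp-≈ setoid (sym (difference g h Cg (trans ¬x≈⋀G ⋀G≈g∧h)))
         (Mem.∈-map⁺ setoid setoid (λ h≈k → ∧-congʳ (¬-cong h≈k)) h∈))
    where
    difference : ∀ g h → C g → ¬ (d ∧ b) ≈ g ∧ h → d ∧ (b ∧ ¬ m) ≈ ¬ h ∧ ¬ m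
    difference g h Cg ¬x≈g∧h = begin
      d ∧ (b ∧ ¬ m)              ≈⟨ ∧-assoc d b (¬ m) ⟨
      (d ∧ b) ∧ ¬ m              ≈⟨ ∧-congʳ x≈¬g∨¬h ⟩
      (¬ g ∨ ¬ h) ∧ ¬ m          ≈⟨ ∧-distribʳ-∨ (¬ m) (¬ g) (¬ h) ⟩
      (¬ g ∧ ¬ m) ∨ (¬ h ∧ ¬ m)  ≈⟨ ∨-congʳ (≤⇒∧¬ ¬g≤m) ⟩
      ⊥ ∨ (¬ h ∧ ¬ m)            ≈⟨ ∨-identityˡ (¬ h ∧ ¬ m) ⟩
      ¬ h ∧ ¬ m                  ∎
      where
      x≈¬g∨¬h : d ∧ b ≈ ¬ g ∨ ¬ h
      x≈¬g∨¬h = begin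
        d ∧ b        ≈⟨ ¬-involutive (d ∧ b) ⟨
        ¬ ¬ (d ∧ b)  ≈⟨ ¬-cong ¬x≈g∧h ⟩
        ¬ (g ∧ h)    ≈⟨ deMorgan₁ g h ⟩
        ¬ g ∨ ¬ h    ∎
      -- `¬ g` is a joinand of `d ∧ b`, so it is a member of `C` below `b`.
      ¬g≤m : ¬ g ≤ m
      ¬g≤m = greatest (C-¬ Cg) (≤-trans (x≤x∨y (¬ g) (¬ h))
               (≤-trans (≤-reflexive (sym x≈¬g∨¬h)) (x∧y≤y d b)))

  ∉C⇒positive-remainder : ∀ {b m} → (C b → Empty) → IsLowerProjection b m → b ∧ ¬ m ≉ ⊥
  ∉C⇒positive-remainder b∉C (Cm , m≤b , _) r≈⊥ = b∉C (C-resp (≤-antisym m≤b (∧¬⇒≤ r≈⊥)) Cm)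

  -- Minimal traces and the equality of `C` with the algebra.

  Trace : Carrier → Pred Carrier (c ⊔ ℓ)
  Trace r x = x ≉ ⊥ × ∃[ d ] C d × x ≈ d ∧ r

  MinimalTrace : Carrier → Pred Carrier (c ⊔ ℓ)
  MinimalTrace r p = Trace r p × (∀ {x} → Trace r x → x ≤ p → x ≈ p)

  minimalTrace : ∀ {b m} → ¬ b ≉ ⊥ → IsLowerProjection b m → b ∧ ¬ m ≉ ⊥ → ∃ (MinimalTrace (b ∧ ¬ m))
  minimalTrace {b} {m} ¬b≉⊥ m-proj r≉⊥ = minimal poset em (traces b m) (Trace (b ∧ ¬ m))
    (λ { (_ , d , Cd , x≈) → Mem.∈-resp-≈ setoid (sym x≈) (trace∈ ¬b≉⊥ m-proj Cd) })
    -- The remainder is its own trace, cut by `⊤`, so a trace exists.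
    (b ∧ ¬ m , r≉⊥ , ⊤ , base , sym (∧-identityˡ (b ∧ ¬ m)))

  trace-≤ : ∀ {r p} → Trace r p → p ≤ r
  trace-≤ {r} (_ , d , _ , p≈d∧r) = ≤-trans (≤-reflexive p≈d∧r) (x∧y≤y d r)

  -- If `u` missed `r`, then `p ≤ r ≤ ¬ u` would give `u ≤ e ≤ ¬ u`. So `u ∧ r` is a trace, and it
  -- lies below `p` because `u ≤ e ≤ d`. Minimality makes it equal to `p`, whence `p ≤ u` and
  -- `e ≤ u`.
  minimalTrace⇒atom : ∀ {r p e} → MinimalTrace r p → IsUpperProjection p e →
                      ∀ {u} → C u → u ≤ e → u ≉ ⊥ → u ≈ e
  minimalTrace⇒atom {r} {p} {e} (p-trace@(_ , d , Cd , p≈d∧r) , p-min) (_ , _ , least-e) {u} Cu u≤e u≉⊥ =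
    ≤-antisym u≤e (least-e Cu (≤-trans (≤-reflexive (sym u∧r≈p)) (x∧y≤x u r)))
    where
    u∧r≉⊥ : u ∧ r ≉ ⊥
    u∧r≉⊥ u∧r≈⊥ = u≉⊥ (≤¬self⇒≈⊥ (≤-trans u≤e (least-e (C-¬ Cu) p≤¬u)))
      where
      p≤¬u : p ≤ ¬ u
      p≤¬u = ≤-trans (trace-≤ p-trace) (disjoint⇒≤¬ (trans (∧-comm r u) u∧r≈⊥))
    u≤d : u ≤ d
    u≤d = ≤-trans u≤e (least-e Cd (≤-trans (≤-reflexive p≈d∧r) (x∧y≤x d r)))
    u∧r≤p : u ∧ r ≤ p
    u∧r≤p = ≤-trans (∧-greatest (≤-trans (x∧y≤x u r) u≤d) (x∧y≤y u r)) (≤-reflexive (sym p≈d∧r))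
    u∧r≈p : u ∧ r ≈ p
    u∧r≈p = p-min (u∧r≉⊥ , u , Cu , refl) u∧r≤p

  trace∉C : ∀ {b m p} → IsLowerProjection b m → Trace (b ∧ ¬ m) p → C p → Empty
  trace∉C {b} {m} {p} (_ , _ , greatest) p-trace Cp =
    proj₁ p-trace (≤¬self⇒≈⊥ (≤-trans p≤r (≤-trans (x∧y≤y b (¬ m)) (¬-antitone p≤m))))
    where
    p≤r : p ≤ b ∧ ¬ m
    p≤r = trace-≤ p-trace
    p≤m : p ≤ m
    p≤m = greatest Cp (≤-trans p≤r (x∧y≤x b (¬ m)))

  -- Outside `C`, `p` would be a proper part of its upper projection `e`; then `C` would contain a
  -- proper part of `e`, although `e` is an atom of `C`.
  minimalTrace∈C : ∀ {r p} → MinimalTrace r p → C p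
  minimalTrace∈C {r} {p} p-min@((p≉⊥ , _) , _) with upperProjection p
  ... | e , e-proj@(Ce , p≤e , _) = em⇒dne em λ p∉C →
    let z , Cz , z≤e , z≉⊥ , z≉e = C-properPart Ce (p≤e , p≉⊥ , λ p≈e → p∉C (C-resp (sym p≈e) Ce))
    in z≉e (minimalTrace⇒atom p-min e-proj Cz z≤e z≉⊥)

  C-all : ∀ b → C b
  C-all b with lowerProjection b
  ... | m , m-proj = em⇒dne em λ b∉C →
    let p , p-min = minimalTrace
          -- If `¬ b` vanished, `b` would be the complement of `⊥`, which lies in `C`.
          (λ ¬b≈⊥ → b∉C (C-resp (trans (¬-cong (sym ¬b≈⊥)) (¬-involutive b)) (C-¬ C-⊥)))
          m-proj (∉C⇒positive-remainder b∉C m-proj)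
    in trace∉C m-proj (proj₁ p-min) (minimalTrace∈C p-min)

  countable : Countable setoid
  countable = Closed⇒countable em C-all

theoremC : ∀ {c ℓ : Level} → ExcludedMiddle (c ⊔ ℓ) →
    (A : BooleanAlgebra c ℓ) →
    ∃ (Separation.IsCoherentFiniteSeparation A) ⇔ Countable (BooleanAlgebra.setoid A)
theoremC em A = mk⇔
  (λ (s , s-coherent) → Separation⇒Countable.countable em A s s-coherent)
  (λ A-countable → let open Countable⇒Separation em A A-countable in sepMap , sepMap-coherent)
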